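{- Fix integers $d\ge1$ and $n>d$. Let $a=(a_1,\dots,a_{n-1})\in[0,1]^{n-1}$ be a global minimizer of the level-$n$ weak-peek problem, i.e. of $L^{\mathrm{wp}}_{d,n}$ over $[0,1]^{n-1}$. Suppose that $a_k=0$ for some $d\le k<n$. Then $$R_d=U_{d,k}(a_1,\dots,a_{k-1}).$$ In particular, the corresponding level-$k$ truncated strategy $(\tfrac12,a_1,\dots,a_{k-1},0,0,\dots)$ is optimal for the distance-$d$ oblivious self-distance rendezvous problem (its expected rendezvous time equals $R_d$).
   Context: Model. An admissible strategy is a sequence $a=(a_i)_{i\ge 0}$ with $a_i\in[0,1]$ and $a_0=\tfrac12$; $\mathcal A$ is the set of admissible strategies. Extend $a$ to a signed sequence $(b_i)_{i\in\mathbb Z}$ by $b_i=a_i$ for $i\ge0$ and $b_i=1-a_{ -i}$ for $i<0$. Two independent Markov chains $(X_t)_{t\ge0},(Y_t)_{t\ge 0}$ on $\mathbb Z$ start at $X_0=Y_0=0$; each moves from $k$ to $k+1$ with probability $b_k$ and to $k-1$ with probability $1-b_k$. For an integer $d\ge1$ the rendezvous time is $\mathcal T_d(a)=\inf\{t\ge0: X_t=Y_t+2d\}$, and $R_d=\inf_{a\in\mathcal A}\mathbb E[\mathcal T_d(a)]$. Truncated chain. Fix $d\ge1$, $n\ge d$ and $a=(a_1,\dots,a_{n-1})\in[0,1]^{n-1}$. Set $a_0=\frac12$, $a_i=0$ for $i\ge n$, and let $b_i=a_i$ for $i\ge0$ and $b_i=1-a_{ -i}$ for $i<0$. The level-$n$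 truncated chain has states $S_{x,y}$ with $-n\le x,y\le n$, $x-y\le 2d$, $x-y$ even; states with $x-y=2d$ are absorbing; from any other state $S_{x,y}$ the two coordinates move independently, $x\mapsto x+1$ with probability $b_x$ and $x\mapsto x-1$ with probability $1-b_x$, and $y\mapsto y+1$ with probability $b_y$ and $y\mapsto y-1$ with probability $1-b_y$. $U_{d,n}(a)\in[0,\infty]$ is the expected hitting time of the absorbing set starting from $S_{0,0}$ ($\infty$ if not finite). Weak-peek chain. Fix $d\ge1$, $n\ge d$, $a=(a_1,\dots,a_{n-1})\in[0,1]^{n-1}$, set $a_0=\frac12$, and for $|i|<n$ let $b_i=a_i$ if $0\le i<n$ and $b_i=1-a_{ -i}$ if $-n<i<0$. The level-$n$ weak-peek chain has states $S_{i,j}$ with $-n\le i\le n+2d$, $-n-2d\le j\le n$, $i-j\le 2d$, $i-j$ even; states with $i-j=2d$ are absorbing. From any other state $S_{i,j}$ the two coordinates move independently: the first moves to $i+1$ with probability $1$ if $|i|\ge n$, and otherwise to $i+1$ with probability $b_i$ and to $i-1$ with probability $1-b_i$; the second moves to $j-1$ with probability $1$ if $|j|\ge n$, and otherwise to $j+1$ with probability $b_j$ and to $j-1$ with probability $1-b_j$. $L^{\mathrm{wp}}_{d,n}(a)\in[0,\infty]$ is the expected hitting time of the absorbing set starting from $S_{0,0}$. -}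

module Defs where

open import Algebra.Bundles using (CommutativeRing)
open import Axiom.ExcludedMiddle using (ExcludedMiddle)
open import Data.Bool.Base using (if_then_else_)
open import Data.Empty using (⊥-elim)
open import Data.Fin.Base using (fromℕ<; inject≤)
open import Data.Integer.Base as ℤ using (ℤ; +_; -[1+_]; ∣_∣)
import Data.Integer.Properties as ℤ
open import Data.List.Base
  using (List; []; _∷_; concatMap; map; foldr; length; takeWhile; cartesianProductWith)
open import Data.Nat.Base as ℕ using (ℕ; zero; suc; _∸_)
import Data.Nat.Properties as ℕ
open import Data.Product.Base using (Σ; ∃; ∃-syntax; _×_; _,_; proj₁; proj₂)
open import Data.Vec.Functional using (Vector)
open import Level as Level using (0ℓ)
open import Relation.Binary.Core using (Rel)
open import Relation.Binary.PropositionalEquality.Core using (_≡_; refl)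
open import Relation.Binary.Structures using (IsTotalOrder)
open import Relation.Nullary.Construct.Add.Extrema using (_±; ⊥±; ⊤±; [_])
open import Relation.Nullary.Decidable.Core using (yes; no; does)
open import Relation.Nullary.Decidable using (¬?)
open import Relation.Nullary.Negation.Core using (¬_)
open import Relation.Unary using (Pred; Decidable)
import Algebra.Definitions.RawMonoid
import Relation.Binary.Construct.Add.Extrema.Equality
import Relation.Binary.Construct.Add.Extrema.NonStrict
import Relation.Binary.Construct.Add.Supremum.NonStrict as Sup

-- The real numbers, given axiomatically: a complete ordered field is unique
-- up to isomorphism, and excluded middle (assumed below) makes one
-- constructible.  The value of 0# ⁻¹ is arbitrary.
record CompleteOrderedField : Set (Level.suc 0ℓ) where
  field
    commutativeRing : CommutativeRing 0ℓ 0ℓ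

  open CommutativeRing commutativeRing public

  infix 8 _⁻¹
  infix 4 _≤_

  field
    _⁻¹          : Carrier → Carrier
    ⁻¹-inverse   : ∀ x → ¬ x ≈ 0# → x * x ⁻¹ ≈ 1#
    0≉1          : ¬ 0# ≈ 1#
    _≤_          : Rel Carrier 0ℓ
    isTotalOrder : IsTotalOrder _≈_ _≤_
    +-monoˡ-≤    : ∀ {x y} z → x ≤ y → x + z ≤ y + z
    *-nonNeg     : ∀ {x y} → 0# ≤ x → 0# ≤ y → 0# ≤ x * y
    completeness : (P : Pred Carrier 0ℓ) → ∃ P →
                   (∃[ u ] (∀ x → P x → x ≤ u)) →
                   ∃[ s ] (∀ x → P x → x ≤ s) ×
                          (∀ u → (∀ x → P x → x ≤ u) → s ≤ u)

module Rendezvous (em : ExcludedMiddle 0ℓ) (ℝ : CompleteOrderedField) where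

  open CompleteOrderedField ℝ
    using (Carrier; _≤_; _+_; _*_; _-_; 1#; _⁻¹; +-rawMonoid; completeness)
  open IsTotalOrder (CompleteOrderedField.isTotalOrder ℝ) using () renaming (trans to ≤-trans)
  open CompleteOrderedField ℝ public using (_≈_; 0#)
  open Algebra.Definitions.RawMonoid +-rawMonoid using () renaming (_×_ to _·_)
  open Relation.Binary.Construct.Add.Extrema.Equality _≈_ public using (_≈±_)
  open Relation.Binary.Construct.Add.Extrema.NonStrict _≤_ public

  ½ : Carrier
  ½ = (1# + 1#) ⁻¹

  ℝ± : Set
  ℝ± = Carrier ±

  IsUpperBound IsLowerBound IsSupremum IsInfimum :
    {I : Set} → (I → ℝ±) → ℝ± → Set
  IsUpperBound f u = ∀ i → f i ≤± u
  IsLowerBound f l = ∀ i → l ≤± f i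
  IsSupremum   f s = IsUpperBound f s × (∀ u → IsUpperBound f u → s ≤± u)
  IsInfimum    f s = IsLowerBound f s × (∀ l → IsLowerBound f l → l ≤± s)

  supremum : {I : Set} (f : I → ℝ±) → ∃ (IsSupremum f)
  supremum {I} f with em {∃[ u ] IsUpperBound f [ u ]}
  ... | no unbounded = ⊤± , (λ i → f i ≤⊤±) , least
    where
    least : ∀ u → IsUpperBound f u → ⊤± ≤± u
    least ⊥±    ub = ⊥-elim (unbounded (0# , λ i → ≤±-trans ≤-trans (ub i) (⊥±≤ [ 0# ])))
    least [ u ] ub = ⊥-elim (unbounded (u , ub))
    least ⊤±    _  = ⊤± ≤⊤±
  ... | yes (b , f≤b) with em {∃[ x ] ∃[ i ] f i ≡ [ x ]}
  ...   | no noReal = ⊥± , (λ i → below (f i) (f≤b i) (λ x e → noReal (x , i , e)))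
                         , (λ u _ → ⊥±≤ u)
    where
    below : ∀ v → v ≤± [ b ] → (∀ x → ¬ v ≡ [ x ]) → v ≤± ⊥±
    below ⊥±    _  _ = ⊥±≤ ⊥±
    below [ x ] _  h = ⊥-elim (h x refl)
    below ⊤±    () _
  ...   | yes (x₀ , i₀ , e₀) = [ s ] , upper , least
    where
    P : Pred Carrier 0ℓ
    P x = ∃[ i ] f i ≡ [ x ]

    bound : ∀ u → IsUpperBound f [ u ] → ∀ x → P x → x ≤ u
    bound u ub x (i , e) with f i | ub i
    bound u ub x (i , refl) | _ | p = [≤]-injective p

    lub : ∃[ s ] (∀ x → P x → x ≤ s) × (∀ u → (∀ x → P x → x ≤ u) → s ≤ u)
    lub = completeness P (x₀ , i₀ , e₀) (b , bound b f≤b)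

    s : Carrier
    s = proj₁ lub

    upper : IsUpperBound f [ s ]
    upper i = go (f i) (f≤b i) (λ x e → proj₁ (proj₂ lub) x (i , e))
      where
      go : ∀ v → v ≤± [ b ] → (∀ x → v ≡ [ x ] → x ≤ s) → v ≤± [ s ]
      go ⊥±    _  _ = ⊥±≤ [ s ]
      go [ x ] _  h = [ h x refl ]
      go ⊤±    () _

    least : ∀ u → IsUpperBound f u → [ s ] ≤± u
    least ⊥± ub = ⊥-elim (absurd e₀ (ub i₀))
      where
      absurd : ∀ {w} → w ≡ [ x₀ ] → ¬ w ≤± ⊥±
      absurd refl Sup.[ () ]
    least [ u ] ub = [ proj₂ (proj₂ lub) u (bound u ub) ]
    least ⊤± _ = [ s ] ≤⊤±

  infimum : {I : Set} (f : I → ℝ±) → ∃ (IsInfimum f)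
  infimum f with supremum {∃ (IsLowerBound f)} proj₁
  ... | s , upper , least =
    s , (λ i → least (f i) (λ (_ , lb) → lb i)) , (λ l lb → upper (l , lb))

  ⨆ ⨅ : {I : Set} → (I → ℝ±) → ℝ±
  ⨆ f = proj₁ (supremum f)
  ⨅ f = proj₁ (infimum f)

  Weighted : Set → Set
  Weighted S = List (Carrier × S)

  Kernel : Set → Set
  Kernel S = S → Weighted S

  independent : {S T : Set} → Kernel S → Kernel T → Kernel (S × T)
  independent K M (s , t) =
    cartesianProductWith (λ (p , s′) (q , t′) → p * q , (s′ , t′)) (K s) (M t)

  absorbing : {S : Set} {A : Pred S 0ℓ} → Decidable A → Kernel S → Kernel S
  absorbing A? K s = if does (A? s) then (1# , s) ∷ [] else K s

  -- Law of the trajectory (X₀ , … , X_{N-1}) of the chain started at s.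
  trajectories : {S : Set} → Kernel S → ℕ → S → Weighted (List S)
  trajectories K zero    s = (1# , []) ∷ []
  trajectories K (suc N) s =
    concatMap (λ (p , s′) → map (λ (q , ω) → p * q , s ∷ ω) (trajectories K N s′)) (K s)

  -- On (X₀ , … , X_{N-1}) this is T ∧ N, where T = inf {t : X_t ∈ A}.
  cappedHit : {S : Set} {A : Pred S 0ℓ} → Decidable A → List S → ℕ
  cappedHit A? ω = length (takeWhile (λ s → ¬? (A? s)) ω)

  expectation : {Ω : Set} → (Ω → Carrier) → Weighted Ω → Carrier
  expectation f = foldr (λ (p , ω) e → p * f ω + e) 0#

  -- E[T] as the supremum over N of E[T ∧ N]; it is ⊤± (that is, ∞) if not finite.
  expectedHit : {S : Set} {A : Pred S 0ℓ} → Decidable A → Kernel S → S → ℝ±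
  expectedHit A? K s =
    ⨆ λ N → [ expectation (λ ω → cappedHit A? ω · 1#) (trajectories K N s) ]

  walk : (ℤ → Carrier) → Kernel ℤ
  walk b k = (b k , k ℤ.+ ℤ.1ℤ) ∷ (1# - b k , k ℤ.- ℤ.1ℤ) ∷ []

  origin : ℤ × ℤ
  origin = ℤ.0ℤ , ℤ.0ℤ

  InUnit : Carrier → Set
  InUnit x = 0# ≤ x × x ≤ 1#

  record Admissible (a : ℕ → Carrier) : Set where
    field
      start  : a 0 ≈ ½
      inUnit : ∀ i → InUnit (a i)

  signed : (ℕ → Carrier) → ℤ → Carrier
  signed a (+ i)    = a i
  signed a -[1+ i ] = 1# - a (suc i)

  Meet : ℕ → Pred (ℤ × ℤ) 0ℓ
  Meet d (x , y) = x ≡ y ℤ.+ + (2 ℕ.* d)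

  meet? : ∀ d → Decidable (Meet d)
  meet? d (x , y) = x ℤ.≟ y ℤ.+ + (2 ℕ.* d)

  E𝒯 : ℕ → (ℕ → Carrier) → ℝ±
  E𝒯 d a = expectedHit (meet? d) (independent (walk b) (walk b)) origin
    where b = signed a

  R : ℕ → ℝ±
  R d = ⨅ {∃ Admissible} (λ (a , _) → E𝒯 d a)

  Optimal : ℕ → (ℕ → Carrier) → Set
  Optimal d a = Admissible a × E𝒯 d a ≈± R d

  -- (a₁ , … , a_{n-1}), with aᵢ stored at index i - 1.
  Parameters : ℕ → Set
  Parameters n = Vector Carrier (n ∸ 1)

  InCube : ∀ n → Parameters n → Set
  InCube n a = ∀ i → InUnit (a i)

  -- The sequence ½ , a₁ , … , a_{n-1} , 0 , 0 , …
  extend : ∀ n → Parameters n → ℕ → Carrier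
  extend n a zero = ½
  extend n a (suc i) with i ℕ.<? (n ∸ 1)
  ... | yes i<n-1 = a (fromℕ< i<n-1)
  ... | no  _     = 0#

  prefix : ∀ {k n} → k ℕ.≤ n → Parameters n → Parameters k
  prefix k≤n a i = a (inject≤ i (ℕ.∸-monoˡ-≤ 1 k≤n))

  Absorbed : ℕ → Pred (ℤ × ℤ) 0ℓ
  Absorbed d (x , y) = x ℤ.- y ≡ + (2 ℕ.* d)

  absorbed? : ∀ d → Decidable (Absorbed d)
  absorbed? d (x , y) = x ℤ.- y ℤ.≟ + (2 ℕ.* d)

  -- Both chains below are written on ℤ × ℤ.  For n ≥ d, each of their finite
  -- state spaces contains the origin and is left with probability zero (steps
  -- change x - y by 0 or ±2), so the bounds on the states are not imposed.

  truncated : ∀ d n → Parameters n → Kernel (ℤ × ℤ)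
  truncated d n a = absorbing (absorbed? d) (independent (walk b) (walk b))
    where b = signed (extend n a)

  U : ∀ d n → Parameters n → ℝ±
  U d n a = expectedHit (absorbed? d) (truncated d n a) origin

  -- Only the values of b at |i| < n are used, so the padding by 0 is irrelevant.
  weakPeek : ∀ d n → Parameters n → Kernel (ℤ × ℤ)
  weakPeek d n a = absorbing (absorbed? d) (independent (walk up₁) (walk up₂))
    where
    b up₁ up₂ : ℤ → Carrier
    b = signed (extend n a)
    up₁ i = if does (n ℕ.≤? ∣ i ∣) then 1# else b i
    up₂ j = if does (n ℕ.≤? ∣ j ∣) then 0# else b j

  Lʷᵖ : ∀ d n → Parameters n → ℝ±
  Lʷᵖ d n a = expectedHit (absorbed? d) (weakPeek d n a) origin

  IsGlobalMinimizer : ∀ n → (Parameters n → ℝ±) → Parameters n → Set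
  IsGlobalMinimizer n f a = InCube n a × (∀ a′ → InCube n a′ → f a ≤± f a′)

{-# OPTIONS --safe #-}
module Submission where

-- Let a′ be the level-k truncation of the minimizer a.  Then
--   R d ≤ E𝒯 d a′ ≤ U d k a′ ≤ Lʷᵖ d n a ≤ R d,
-- so all four agree.  For the third inequality, aₖ = 0 reflects both walks at ±k,
-- hence they never reach the levels where the weak-peek chain differs.  For the
-- last one, Lʷᵖ d n a ≤ Lʷᵖ d n α ≤ E𝒯 d α for every admissible α: the weak-peek
-- up-probabilities are at least those of α for the first walk and at most those of
-- α for the second.  Walks whose distance is even cannot jump over each other, so
-- the chains can be coupled with X′ ≥ X and Y′ ≤ Y (primes for weak peek), and
-- X′ - Y′, which changes by 0 or ±2, reaches 2d no later than X - Y.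

open import Axiom.ExcludedMiddle using (ExcludedMiddle)
open import Data.Bool.Base using (if_then_else_)
open import Data.Empty using (⊥-elim)
open import Data.Fin.Base using (fromℕ<; inject≤; toℕ)
open import Data.Fin.Properties using (toℕ-fromℕ<; toℕ-inject≤; toℕ-injective)
open import Data.Integer.Base as ℤ using (ℤ; +_; -[1+_]; ∣_∣; 0ℤ; 1ℤ)
import Data.Integer.Properties as ℤ
open import Data.Integer.Tactic.RingSolver using (solve-∀)
open import Data.List.Base using (List; []; _∷_; _++_; concatMap; map)
open import Data.List.Relation.Unary.All using (All; []; _∷_)
open import Data.List.Relation.Unary.All.Properties using (++⁺)
open import Data.Nat.Base as ℕ using (ℕ; zero; suc; _≤_; _<_; z≤n; s≤s)
import Data.Nat.Properties as ℕ
open import Data.Nat.Properties using (<⇒≤)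
open import Data.Product.Base using (_×_; _,_; proj₁; proj₂; ∃)
open import Data.Sum.Base as Sum using (_⊎_; inj₁; inj₂)
open import Function.Base using (_∘_)
open import Level using (0ℓ)
open import Relation.Binary.Bundles using (Poset)
open import Relation.Binary.PropositionalEquality.Core as ≡ using (_≡_)
open import Relation.Binary.Structures using (IsTotalOrder)
open import Relation.Nullary.Construct.Add.Extrema using ([_])
open import Relation.Nullary.Decidable using (Dec; yes; no; does; dec-true; dec-false)
open import Relation.Nullary.Negation.Core using (¬_)
open import Relation.Unary using (Pred; Decidable)
import Algebra.Definitions.RawMonoid
import Algebra.Properties.Ring
import Algebra.Solver.Ring.NaturalCoefficients.Default
import Relation.Binary.Reasoning.PartialOrder
open import Defs

-- Integers at an even nonnegative distance

infix 4 _⊒_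

-- Evenness is built into the order because it is what prevents crossing: a distance that is not 0
-- is at least 2, and one step of both points lowers it by at most 2. The index `m` is half the
-- distance, and doubling is written as a sum so that the ring solver can treat `+ m` as a variable.
data _⊒_ (z x : ℤ) : Set where
  gap : ∀ m → z ≡ x ℤ.+ (+ m ℤ.+ + m) → z ⊒ x

⊒-refl : ∀ x → x ⊒ x
⊒-refl x = gap 0 (≡.sym (ℤ.+-identityʳ x))

⊒⇒≥ : ∀ {z x} → z ⊒ x → x ℤ.≤ z
⊒⇒≥ {x = x} (gap m ≡.refl) = ℤ.i≤i+j x (+ (m ℕ.+ m))

⊒-shift : ∀ c {z x} → z ⊒ x → z ℤ.+ c ⊒ x ℤ.+ c
⊒-shift c {x = x} (gap m ≡.refl) = gap m (regroup x (+ m) c)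
  where
  regroup : ∀ x m c → x ℤ.+ (m ℤ.+ m) ℤ.+ c ≡ x ℤ.+ c ℤ.+ (m ℤ.+ m)
  regroup = solve-∀

⊒-apart : ∀ {z x} → z ⊒ x → z ℤ.+ 1ℤ ⊒ x ℤ.- 1ℤ
⊒-apart {x = x} (gap m ≡.refl) = gap (suc m) (regroup x (+ m))
  where
  regroup : ∀ x m → x ℤ.+ (m ℤ.+ m) ℤ.+ 1ℤ ≡ x ℤ.- 1ℤ ℤ.+ ((1ℤ ℤ.+ m) ℤ.+ (1ℤ ℤ.+ m))
  regroup = solve-∀

-- Moving towards each other is the only pair of steps that can break the order, and by parity it
-- does so only from distance 0.
⊒-approach : ∀ {z x} → z ⊒ x → z ≡ x ⊎ z ℤ.- 1ℤ ⊒ x ℤ.+ 1ℤ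
⊒-approach {x = x} (gap zero    ≡.refl) = inj₁ (ℤ.+-identityʳ x)
⊒-approach {x = x} (gap (suc m) ≡.refl) = inj₂ (gap m (regroup x (+ m)))
  where
  regroup : ∀ x m → x ℤ.+ ((1ℤ ℤ.+ m) ℤ.+ (1ℤ ℤ.+ m)) ℤ.- 1ℤ ≡ x ℤ.+ 1ℤ ℤ.+ (m ℤ.+ m)
  regroup = solve-∀

Neighbour : ℤ → ℤ → Set
Neighbour x u = u ≡ x ℤ.+ 1ℤ ⊎ u ≡ x ℤ.- 1ℤ

-- With `c` equal to 2d this is the absence of overshoot: before absorption the gap between `x` and
-- `y + c` is at least 2, so it survives even a step of `x` up and of `y` down.
⊒-neighbours : ∀ {x y u v} c → ¬ x ≡ y ℤ.+ c → y ℤ.+ c ⊒ x →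
  Neighbour x u → Neighbour y v → v ℤ.+ c ⊒ u
⊒-neighbours {x} {y} c x≢y+c y+c⊒x = go
  where
  swap : ∀ e → y ℤ.+ c ℤ.+ e ≡ y ℤ.+ e ℤ.+ c
  swap = regroup y c
    where
    regroup : ∀ y c e → y ℤ.+ c ℤ.+ e ≡ y ℤ.+ e ℤ.+ c
    regroup = solve-∀

  go : ∀ {u v} → Neighbour x u → Neighbour y v → v ℤ.+ c ⊒ u
  go (inj₁ ≡.refl) (inj₁ ≡.refl) = ≡.subst (_⊒ _) (swap 1ℤ) (⊒-shift 1ℤ y+c⊒x)
  go (inj₂ ≡.refl) (inj₁ ≡.refl) = ≡.subst (_⊒ _) (swap 1ℤ) (⊒-apart y+c⊒x)
  go (inj₂ ≡.refl) (inj₂ ≡.refl) = ≡.subst (_⊒ _) (swap ℤ.-1ℤ) (⊒-shift ℤ.-1ℤ y+c⊒x)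
  go (inj₁ ≡.refl) (inj₂ ≡.refl) with ⊒-approach y+c⊒x
  ... | inj₁ y+c≡x = ⊥-elim (x≢y+c (≡.sym y+c≡x))
  ... | inj₂ closer = ≡.subst (_⊒ _) (swap ℤ.-1ℤ) closer

meet⇒absorbed : ∀ {x y} c → x ≡ y ℤ.+ c → x ℤ.- y ≡ c
meet⇒absorbed {y = y} c ≡.refl = regroup y c
  where
  regroup : ∀ y c → y ℤ.+ c ℤ.- y ≡ c
  regroup = solve-∀

absorbed⇒meet : ∀ {x y} c → x ℤ.- y ≡ c → x ≡ y ℤ.+ c
absorbed⇒meet {x} {y} _ ≡.refl = regroup x y
  where
  regroup : ∀ x y → x ≡ y ℤ.+ (x ℤ.- y)
  regroup = solve-∀

-- The exceptional alternative, here and in the mirrored lemma, is the endpoint at which a reflected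
-- walk takes the outward step with probability 0.
∣i+1∣≤k : ∀ i {k} → ∣ i ∣ ≤ k → ∣ i ℤ.+ 1ℤ ∣ ≤ k ⊎ i ≡ + k
∣i+1∣≤k (+ m) {k} m≤k with ℕ.m≤n⇒m<n∨m≡n m≤k
... | inj₁ m<k    = inj₁ (≡.subst (ℕ._≤ k) (ℕ.+-comm 1 m) m<k)
... | inj₂ ≡.refl = inj₂ ≡.refl
∣i+1∣≤k -[1+ zero  ] _     = inj₁ z≤n
∣i+1∣≤k -[1+ suc m ] 2+m≤k = inj₁ (<⇒≤ 2+m≤k)

∣i-1∣≤k : ∀ i {k} → 1 ≤ k → ∣ i ∣ ≤ k → ∣ i ℤ.- 1ℤ ∣ ≤ k ⊎ i ≡ ℤ.- + k
∣i-1∣≤k (+ zero)  1≤k _     = inj₁ 1≤k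
∣i-1∣≤k (+ suc m) 1≤k 1+m≤k = inj₁ (<⇒≤ 1+m≤k)
∣i-1∣≤k -[1+ m ] {k} 1≤k 1+m≤k with ℕ.m≤n⇒m<n∨m≡n 1+m≤k
... | inj₁ 2+m≤k  = inj₁ (≡.subst (λ j → suc (suc j) ≤ k) (≡.sym (ℕ.+-identityʳ m)) 2+m≤k)
... | inj₂ ≡.refl = inj₂ ≡.refl

if-dec-elim : ∀ {A X : Set} (P : X → Set) (A? : Dec A) {x y} →
  (A → P x) → (¬ A → P y) → P (if does A? then x else y)
if-dec-elim P (yes a) Px Py = Px a
if-dec-elim P (no ¬a) Px Py = Py ¬a

-- Arithmetic in an ordered field

module OrderedField (ℝ : CompleteOrderedField) where

  open CompleteOrderedField ℝ hiding (_≤_) public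
  open CompleteOrderedField ℝ using () renaming (_≤_ to _≼_) public
  open IsTotalOrder isTotalOrder public
    using (total; antisym; isPartialOrder; ≤-respʳ-≈; ≤-respˡ-≈)
    renaming (refl to ≼-refl; trans to ≼-trans; reflexive to ≼-reflexive)
  open Algebra.Properties.Ring ring public
  open Algebra.Solver.Ring.NaturalCoefficients.Default commutativeSemiring public
    using (_:+_; _:*_; _:=_) renaming (solve to solveℝ)

  ≼-poset : Poset 0ℓ 0ℓ 0ℓ
  ≼-poset = record { isPartialOrder = isPartialOrder }

  module ≼-Reasoning = Relation.Binary.Reasoning.PartialOrder ≼-poset
  open ≼-Reasoning

  +-mono : ∀ {x y u v} → x ≼ y → u ≼ v → x + u ≼ y + v
  +-mono {x} {y} {u} {v} x≼y u≼v = begin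
    x + u ≤⟨ +-monoˡ-≤ u x≼y ⟩
    y + u ≈⟨ +-comm y u ⟩
    u + y ≤⟨ +-monoˡ-≤ y u≼v ⟩
    v + y ≈⟨ +-comm v y ⟩
    y + v ∎

  x+[y-x]≈y : ∀ x y → x + (y - x) ≈ y
  x+[y-x]≈y x y = begin-equality
    x + (y - x)   ≈⟨ +-congˡ (+-comm y (- x)) ⟩
    x + (- x + y) ≈⟨ +-assoc x (- x) y ⟨
    x - x + y     ≈⟨ +-congʳ (-‿inverseʳ x) ⟩
    0# + y        ≈⟨ +-identityˡ y ⟩
    y             ∎

  x≼y⇒0≼y-x : ∀ {x y} → x ≼ y → 0# ≼ y - x
  x≼y⇒0≼y-x {x} {y} x≼y = begin
    0#    ≈⟨ -‿inverseʳ x ⟨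
    x - x ≤⟨ +-monoˡ-≤ (- x) x≼y ⟩
    y - x ∎

  *-monoˡ : ∀ {c x y} → 0# ≼ c → x ≼ y → c * x ≼ c * y
  *-monoˡ {c} {x} {y} 0≼c x≼y = begin
    c * x               ≈⟨ +-identityʳ (c * x) ⟨
    c * x + 0#          ≤⟨ +-mono ≼-refl (*-nonNeg 0≼c (x≼y⇒0≼y-x x≼y)) ⟩
    c * x + c * (y - x) ≈⟨ distribˡ c x (y - x) ⟨
    c * (x + (y - x))   ≈⟨ *-congˡ (x+[y-x]≈y x y) ⟩
    c * y               ∎

  neg-antitone : ∀ {x y} → x ≼ y → - y ≼ - x
  neg-antitone {x} {y} x≼y = begin
    - y           ≈⟨ +-identityʳ (- y) ⟨
    - y + 0#      ≤⟨ +-mono ≼-refl (x≼y⇒0≼y-x x≼y) ⟩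
    - y + (y - x) ≈⟨ +-assoc (- y) y (- x) ⟨
    - y + y - x   ≈⟨ +-congʳ (-‿inverseˡ y) ⟩
    0# - x        ≈⟨ +-identityˡ (- x) ⟩
    - x           ∎

  -- Used with `c` a transition probability: values need to be compared only at sites that are
  -- actually reached.
  *-monoˡ-support : ∀ {c x y} → 0# ≼ c → x ≼ y ⊎ c ≈ 0# → c * x ≼ c * y
  *-monoˡ-support         0≼c (inj₁ x≼y) = *-monoˡ 0≼c x≼y
  *-monoˡ-support {c} {x} {y} _ (inj₂ c≈0) = begin
    c * x  ≈⟨ *-congʳ c≈0 ⟩
    0# * x ≈⟨ zeroˡ x ⟩
    0#     ≈⟨ zeroˡ y ⟨
    0# * y ≈⟨ *-congʳ c≈0 ⟨
    c * y  ∎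

  0≼1 : 0# ≼ 1#
  0≼1 with total 0# 1#
  ... | inj₁ 0≼1 = 0≼1
  ... | inj₂ 1≼0 = begin
    0#           ≤⟨ *-nonNeg 0≼-1 0≼-1 ⟩
    - 1# * - 1#  ≈⟨ -1*x≈-x (- 1#) ⟩
    - - 1#       ≈⟨ -‿involutive 1# ⟩
    1#           ∎
    where
    0≼-1 : 0# ≼ - 1#
    0≼-1 = ≤-respʳ-≈ (+-identityˡ (- 1#)) (x≼y⇒0≼y-x 1≼0)

  2≉0 : ¬ 1# + 1# ≈ 0#
  2≉0 2≈0 = 0≉1 (antisym 0≼1 (begin
    1#      ≈⟨ +-identityʳ 1# ⟨
    1# + 0# ≤⟨ +-mono ≼-refl 0≼1 ⟩
    1# + 1# ≈⟨ 2≈0 ⟩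
    0#      ∎))

  -- When d′ ≼ u fails, p ≼ p′ and the surplus weight p′ - p on u′ is matched with d.
  convex-mono : ∀ {p p̄ p′ p̄′ u d u′ d′} →
    0# ≼ p → 0# ≼ p̄ → 0# ≼ p′ → 0# ≼ p̄′ → p + p̄ ≈ 1# → p′ + p̄′ ≈ 1# →
    u′ ≼ u → d′ ≼ d → u′ ≼ d → d′ ≼ u ⊎ p ≼ p′ →
    p′ * u′ + p̄′ * d′ ≼ p * u + p̄ * d
  convex-mono {p} {p̄} {p′} {p̄′} {u} {d} {u′} {d′}
    0≼p 0≼p̄ 0≼p′ 0≼p̄′ p+p̄≈1 p′+p̄′≈1 u′≼u d′≼d u′≼d (inj₁ d′≼u) = begin
    p′ * u′ + p̄′ * d′ ≤⟨ +-mono (*-monoˡ 0≼p′ (below u′≼u u′≼d))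
                                 (*-monoˡ 0≼p̄′ (below d′≼u d′≼d)) ⟩
    p′ * m + p̄′ * m   ≈⟨ distribʳ m p′ p̄′ ⟨
    (p′ + p̄′) * m     ≈⟨ *-congʳ p′+p̄′≈1 ⟩
    1# * m             ≈⟨ *-identityˡ m ⟩
    m                  ∎
    where
    -- In this case both values on the left lie below both values on the right, hence below the
    -- average `m` of the latter.
    m : Carrier
    m = p * u + p̄ * d
    below : ∀ {c} → c ≼ u → c ≼ d → c ≼ m
    below {c} c≼u c≼d = begin
      c              ≈⟨ *-identityˡ c ⟨
      1# * c         ≈⟨ *-congʳ p+p̄≈1 ⟨
      (p + p̄) * c   ≈⟨ distribʳ c p p̄ ⟩
      p * c + p̄ * c ≤⟨ +-mono (*-monoˡ 0≼p c≼u) (*-monoˡ 0≼p̄ c≼d) ⟩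
      m              ∎
  convex-mono {p} {p̄} {p′} {p̄′} {u} {d} {u′} {d′}
    0≼p 0≼p̄ 0≼p′ 0≼p̄′ p+p̄≈1 p′+p̄′≈1 u′≼u d′≼d u′≼d (inj₂ p≼p′) = begin
    p′ * u′ + p̄′ * d′          ≈⟨ +-congʳ (*-congʳ (x+[y-x]≈y p p′)) ⟨
    (p + e) * u′ + p̄′ * d′     ≈⟨ +-congʳ (distribʳ u′ p e) ⟩
    p * u′ + e * u′ + p̄′ * d′  ≤⟨ +-mono (+-mono (*-monoˡ 0≼p u′≼u)
                                                  (*-monoˡ (x≼y⇒0≼y-x p≼p′) u′≼d))
                                          (*-monoˡ 0≼p̄′ d′≼d) ⟩
    p * u + e * d + p̄′ * d     ≈⟨ solveℝ 5 (λ p u e d q → p :* u :+ e :* d :+ q :* d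
                                     := p :* u :+ (e :+ q) :* d) refl p u e d p̄′ ⟩
    p * u + (e + p̄′) * d       ≈⟨ +-congˡ (*-congʳ e+p̄′≈p̄) ⟩
    p * u + p̄ * d              ∎
    where
    e : Carrier
    e = p′ - p
    e+p̄′≈p̄ : e + p̄′ ≈ p̄
    e+p̄′≈p̄ = +-cancelˡ p (e + p̄′) p̄ (begin-equality
      p + (e + p̄′)  ≈⟨ +-assoc p e p̄′ ⟨
      p + e + p̄′    ≈⟨ +-congʳ (x+[y-x]≈y p p′) ⟩
      p′ + p̄′       ≈⟨ p′+p̄′≈1 ⟩
      1#             ≈⟨ p+p̄≈1 ⟨
      p + p̄         ∎)

module _ (em : ExcludedMiddle 0ℓ) (ℝ : CompleteOrderedField) where

  open OrderedField ℝ
  open ≼-Reasoning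
  open Algebra.Definitions.RawMonoid +-rawMonoid using () renaming (_×_ to _·_)
  open Rendezvous em ℝ hiding (_≈_; 0#)

  private
    variable
      S T Ω : Set

  -- Probabilities in the unit interval, and suprema

  1-0≈1 : 1# - 0# ≈ 1#
  1-0≈1 = trans (+-congˡ -0#≈0#) (+-identityʳ 1#)

  1-x∈[0,1] : ∀ {x} → InUnit x → InUnit (1# - x)
  1-x∈[0,1] {x} (0≼x , x≼1) = x≼y⇒0≼y-x x≼1 , (begin
    1# - x        ≈⟨ +-identityˡ (1# - x) ⟨
    0# + (1# - x) ≤⟨ +-monoˡ-≤ (1# - x) 0≼x ⟩
    x + (1# - x)  ≈⟨ x+[y-x]≈y x 1# ⟩
    1#            ∎)

  0∈[0,1] : InUnit 0#
  0∈[0,1] = ≼-refl , 0≼1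

  1∈[0,1] : InUnit 1#
  1∈[0,1] = 0≼1 , ≼-refl

  ½+½≈1 : ½ + ½ ≈ 1#
  ½+½≈1 = begin-equality
    ½ + ½             ≈⟨ +-cong (*-identityˡ ½) (*-identityˡ ½) ⟨
    1# * ½ + 1# * ½   ≈⟨ distribʳ ½ 1# 1# ⟨
    (1# + 1#) * ½     ≈⟨ ⁻¹-inverse (1# + 1#) 2≉0 ⟩
    1#                ∎

  0≼½ : 0# ≼ ½
  0≼½ with total 0# ½
  ... | inj₁ 0≼½ = 0≼½
  ... | inj₂ ½≼0 = ⊥-elim (0≉1 (antisym 0≼1 (begin
    1#      ≈⟨ ½+½≈1 ⟨
    ½ + ½   ≤⟨ +-mono ½≼0 ½≼0 ⟩
    0# + 0# ≈⟨ +-identityʳ 0# ⟩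
    0#      ∎)))

  ½∈[0,1] : InUnit ½
  ½∈[0,1] = 0≼½ , (begin
    ½      ≈⟨ +-identityʳ ½ ⟨
    ½ + 0# ≤⟨ +-mono ≼-refl 0≼½ ⟩
    ½ + ½  ≈⟨ ½+½≈1 ⟩
    1#     ∎)

  ⨆-mono : {I : Set} {f g : I → ℝ±} → (∀ i → f i ≤± g i) → ⨆ f ≤± ⨆ g
  ⨆-mono {f = f} {g} f≤g = proj₂ (proj₂ (supremum f)) (⨆ g)
    λ i → ≤±-trans ≼-trans (f≤g i) (proj₁ (proj₂ (supremum g)) i)

  -- Weighted lists

  mass : Weighted Ω → Carrier
  mass = expectation (λ _ → 1#)

  NonNegative : Weighted Ω → Set
  NonNegative = All (λ (p , _) → 0# ≼ p)

  expectation-cong : ∀ {f g : Ω → Carrier} → (∀ ω → f ω ≈ g ω) →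
    ∀ μ → expectation f μ ≈ expectation g μ
  expectation-cong f≈g []            = refl
  expectation-cong f≈g ((p , ω) ∷ μ) = +-cong (*-congˡ (f≈g ω)) (expectation-cong f≈g μ)

  expectation-mono : ∀ {f g : Ω → Carrier} → (∀ ω → f ω ≼ g ω) →
    ∀ {μ} → NonNegative μ → expectation f μ ≼ expectation g μ
  expectation-mono f≼g []                       = ≼-refl
  expectation-mono f≼g {(p , ω) ∷ μ} (0≼p ∷ 0≼) =
    +-mono (*-monoˡ 0≼p (f≼g ω)) (expectation-mono f≼g 0≼)

  expectation-+ : ∀ (f g : Ω → Carrier) μ →
    expectation (λ ω → f ω + g ω) μ ≈ expectation f μ + expectation g μ
  expectation-+ f g []            = sym (+-identityʳ 0#)
  expectation-+ f g ((p , ω) ∷ μ) = begin-equality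
    p * (f ω + g ω) + expectation (λ ω → f ω + g ω) μ ≈⟨ +-congˡ (expectation-+ f g μ) ⟩
    p * (f ω + g ω) + (expectation f μ + expectation g μ)
      ≈⟨ solveℝ 5 (λ p x y u v → p :* (x :+ y) :+ (u :+ v) := p :* x :+ u :+ (p :* y :+ v))
           refl p (f ω) (g ω) (expectation f μ) (expectation g μ) ⟩
    p * f ω + expectation f μ + (p * g ω + expectation g μ) ∎

  expectation-0 : ∀ (μ : Weighted Ω) → expectation (λ _ → 0#) μ ≈ 0#
  expectation-0 []            = refl
  expectation-0 ((p , ω) ∷ μ) = trans (+-cong (zeroʳ p) (expectation-0 μ)) (+-identityʳ 0#)

  expectation-++ : ∀ (f : Ω → Carrier) μ ν →
    expectation f (μ ++ ν) ≈ expectation f μ + expectation f ν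
  expectation-++ f []            ν = sym (+-identityˡ _)
  expectation-++ f ((p , ω) ∷ μ) ν = trans (+-congˡ (expectation-++ f μ ν)) (sym (+-assoc _ _ _))

  -- The common building block of `independent` and `trajectories`: both concatenate lists of this
  -- shape.
  scaled : Carrier → (T → Ω) → Weighted T → Weighted Ω
  scaled p g = map (λ (q , t) → p * q , g t)

  expectation-scaled : ∀ (f : Ω → Carrier) p (g : T → Ω) μ →
    expectation f (scaled p g μ) ≈ p * expectation (f ∘ g) μ
  expectation-scaled f p g []            = sym (zeroʳ p)
  expectation-scaled f p g ((q , t) ∷ μ) = begin-equality
    p * q * f (g t) + expectation f (scaled p g μ)
      ≈⟨ +-cong (*-assoc p q (f (g t))) (expectation-scaled f p g μ) ⟩
    p * (q * f (g t)) + p * expectation (f ∘ g) μ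
      ≈⟨ distribˡ p _ _ ⟨
    p * (q * f (g t) + expectation (f ∘ g) μ) ∎

  nonNegative-scaled : ∀ {p} (g : T → Ω) → 0# ≼ p →
    ∀ {μ} → NonNegative μ → NonNegative (scaled p g μ)
  nonNegative-scaled g 0≼p []         = []
  nonNegative-scaled g 0≼p (0≼q ∷ 0≼) = *-nonNeg 0≼p 0≼q ∷ nonNegative-scaled g 0≼p 0≼

  -- The tower property: average first over the continuation, then over the first draw.
  expectation-bind : ∀ (f : Ω → Carrier) (g : S → T → Ω) (K : S → Weighted T) μ →
    expectation f (concatMap (λ (p , s) → scaled p (g s) (K s)) μ) ≈
    expectation (λ s → expectation (f ∘ g s) (K s)) μ
  expectation-bind f g K []            = refl
  expectation-bind f g K ((p , s) ∷ μ) = trans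
    (expectation-++ f (scaled p (g s) (K s)) _)
    (+-cong (expectation-scaled f p (g s) (K s)) (expectation-bind f g K μ))

  expectation-product : ∀ (f : S × T → Carrier) (K : Kernel S) (M : Kernel T) s t →
    expectation f (independent K M (s , t)) ≈
    expectation (λ u → expectation (λ v → f (u , v)) (M t)) (K s)
  expectation-product {S} {T} f K M s t = go (K s)
    where
    -- Fubini by induction on the first list. Freeing `K s` to an arbitrary `μ`, wrapped in a
    -- constant kernel, keeps the goal in terms of `independent`.
    go : ∀ μ → expectation f (independent (λ _ → μ) M (s , t)) ≈
               expectation (λ u → expectation (λ v → f (u , v)) (M t)) μ
    go []            = refl
    go ((p , u) ∷ μ) = trans
      (expectation-++ f (scaled p (u ,_) (M t)) _)
      (+-cong (expectation-scaled f p (u ,_) (M t)) (go μ))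

  -- Source and target types may differ, so that the notion also covers `trajectories K N`, whose
  -- values are laws on lists of states.
  Stochastic : (S → Weighted T) → Set
  Stochastic K = ∀ s → NonNegative (K s) × mass (K s) ≈ 1#

  stochastic-walk : ∀ {b} → (∀ i → InUnit (b i)) → Stochastic (walk b)
  stochastic-walk {b} b∈ i = proj₁ (b∈ i) ∷ proj₁ (1-x∈[0,1] (b∈ i)) ∷ [] , (begin-equality
    b i * 1# + ((1# - b i) * 1# + 0#)
      ≈⟨ +-cong (*-identityʳ (b i)) (trans (+-identityʳ _) (*-identityʳ _)) ⟩
    b i + (1# - b i) ≈⟨ x+[y-x]≈y (b i) 1# ⟩
    1#               ∎)

  stochastic-independent : ∀ {K : Kernel S} {M : Kernel T} →
    Stochastic K → Stochastic M → Stochastic (independent K M)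
  stochastic-independent {K = K} {M} stK stM (s , t) = go (proj₁ (stK s)) , (begin-equality
    mass (independent K M (s , t))       ≈⟨ expectation-product (λ _ → 1#) K M s t ⟩
    expectation (λ _ → mass (M t)) (K s) ≈⟨ expectation-cong (λ _ → proj₂ (stM t)) (K s) ⟩
    mass (K s)                           ≈⟨ proj₂ (stK s) ⟩
    1#                                   ∎)
    where
    go : ∀ {μ} → NonNegative μ → NonNegative (independent (λ _ → μ) M (s , t))
    go []         = []
    go (0≼p ∷ 0≼) = ++⁺ (nonNegative-scaled _ 0≼p (proj₁ (stM t))) (go 0≼)

  stochastic-absorbing : ∀ {A : Pred S 0ℓ} (A? : Decidable A) {K} →
    Stochastic K → Stochastic (absorbing A? K)
  stochastic-absorbing A? stK s with A? s
  ... | yes _ = 0≼1 ∷ [] , trans (+-identityʳ _) (*-identityʳ 1#)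
  ... | no  _ = stK s

  stochastic-trajectories : ∀ {K : Kernel S} → Stochastic K →
    ∀ N → Stochastic (trajectories K N)
  stochastic-trajectories stK zero s = 0≼1 ∷ [] , trans (+-identityʳ _) (*-identityʳ 1#)
  stochastic-trajectories {K = K} stK (suc N) s = go (proj₁ (stK s)) , (begin-equality
    mass (trajectories K (suc N) s)
      ≈⟨ expectation-bind (λ _ → 1#) (λ _ → s ∷_) (trajectories K N) (K s) ⟩
    expectation (λ s′ → mass (trajectories K N s′)) (K s)
      ≈⟨ expectation-cong (λ s′ → proj₂ (stochastic-trajectories stK N s′)) (K s) ⟩
    mass (K s)
      ≈⟨ proj₂ (stK s) ⟩
    1# ∎)
    where
    go : ∀ {μ} → NonNegative μ →
      NonNegative (concatMap (λ (p , s′) → scaled p (s ∷_) (trajectories K N s′)) μ)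
    go []                     = []
    go {(_ , s′) ∷ _} (0≼p ∷ 0≼) =
      ++⁺ (nonNegative-scaled _ 0≼p (proj₁ (stochastic-trajectories stK N s′))) (go 0≼)

  expectation-1+ : ∀ (f : Ω → Carrier) μ → mass μ ≈ 1# →
    expectation (λ ω → 1# + f ω) μ ≈ 1# + expectation f μ
  expectation-1+ f μ mass≈1 = trans (expectation-+ (λ _ → 1#) f μ) (+-congʳ mass≈1)

  -- Capped hitting times

  module _ {A : Pred S 0ℓ} (A? : Decidable A) {K : Kernel S} (stK : Stochastic K) where

    capped : List S → Carrier
    capped ω = cappedHit A? ω · 1#

    E[T∧_] : ℕ → S → Carrier
    E[T∧ N ] s = expectation capped (trajectories K N s)

    E[T∧0]≈0 : ∀ s → E[T∧ 0 ] s ≈ 0#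
    E[T∧0]≈0 s = trans (+-identityʳ _) (zeroʳ 1#)

    E[T∧N]-nonNegative : ∀ N s → 0# ≼ E[T∧ N ] s
    E[T∧N]-nonNegative N s = begin
      0#                                        ≈⟨ expectation-0 (trajectories K N s) ⟨
      expectation (λ _ → 0#) (trajectories K N s)
        ≤⟨ expectation-mono (λ ω → n·1-nonNegative (cappedHit A? ω))
             (proj₁ (stochastic-trajectories stK N s)) ⟩
      E[T∧ N ] s                                ∎
      where
      n·1-nonNegative : ∀ n → 0# ≼ n · 1#
      n·1-nonNegative zero    = ≼-refl
      n·1-nonNegative (suc n) = ≤-respˡ-≈ (+-identityʳ 0#) (+-mono 0≼1 (n·1-nonNegative n))

    E[T∧suc] : ∀ N s → E[T∧ suc N ] s ≈
      expectation (λ s′ → expectation (λ ω → capped (s ∷ ω)) (trajectories K N s′)) (K s)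
    E[T∧suc] N s = expectation-bind capped (λ _ → s ∷_) (trajectories K N) (K s)

    -- `takeWhile` stops at the head of the trajectory, whatever `K` does afterwards; this makes
    -- chains frozen on hitting comparable with chains that run on.
    E[T∧N]-hit : ∀ N {s} → A s → E[T∧ N ] s ≈ 0#
    E[T∧N]-hit zero    {s} _  = E[T∧0]≈0 s
    E[T∧N]-hit (suc N) {s} As = begin-equality
      E[T∧ suc N ] s ≈⟨ E[T∧suc] N s ⟩
      expectation (λ s′ → expectation (λ ω → capped (s ∷ ω)) (trajectories K N s′)) (K s)
        ≈⟨ expectation-cong (λ s′ → trans
             (expectation-cong capped≈0 (trajectories K N s′))
             (expectation-0 (trajectories K N s′))) (K s) ⟩
      expectation (λ _ → 0#) (K s) ≈⟨ expectation-0 (K s) ⟩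
      0# ∎
      where
      capped≈0 : ∀ ω → capped (s ∷ ω) ≈ 0#
      capped≈0 ω rewrite dec-true (A? s) As = refl

    -- First-step analysis. The current state contributes 1 to every trajectory, and total mass 1
    -- allows this constant to be pulled out of both expectations.
    E[T∧N]-step : ∀ N {s} → ¬ A s → E[T∧ suc N ] s ≈ 1# + expectation E[T∧ N ] (K s)
    E[T∧N]-step N {s} ¬As = begin-equality
      E[T∧ suc N ] s ≈⟨ E[T∧suc] N s ⟩
      expectation (λ s′ → expectation (λ ω → capped (s ∷ ω)) (trajectories K N s′)) (K s)
        ≈⟨ expectation-cong (λ s′ → trans
             (expectation-cong capped≈1+ (trajectories K N s′))
             (expectation-1+ capped (trajectories K N s′) (proj₂ (stochastic-trajectories stK N s′)))) (K s) ⟩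
      expectation (λ s′ → 1# + E[T∧ N ] s′) (K s)
        ≈⟨ expectation-1+ E[T∧ N ] (K s) (proj₂ (stK s)) ⟩
      1# + expectation E[T∧ N ] (K s) ∎
      where
      capped≈1+ : ∀ ω → capped (s ∷ ω) ≈ 1# + capped ω
      capped≈1+ ω rewrite dec-false (A? s) ¬As = refl

  -- Stochastic domination and comparison of hitting times

  -- Dual form of stochastic domination: by Strassen's theorem this says that μ
  -- and ν have a coupling concentrated on R.
  infix 4 _⊑[_]_
  record _⊑[_]_ (μ : Weighted S) (R : S → T → Set) (ν : Weighted T) : Set where
    constructor dominated
    field
      expectation-≼ : ∀ f g → (∀ {s t} → R s t → f s ≼ g t) →
        expectation f μ ≼ expectation g ν
  open _⊑[_]_

  ⊑-weaken : ∀ {P Q : S → T → Set} {μ ν} →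
    (∀ {s t} → P s t → Q s t) → μ ⊑[ P ] ν → μ ⊑[ Q ] ν
  ⊑-weaken P⇒Q μ⊑ν = dominated λ f g f≼g → expectation-≼ μ⊑ν f g (f≼g ∘ P⇒Q)

  ⊑-refl : ∀ {μ : Weighted S} → NonNegative μ → μ ⊑[ _≡_ ] μ
  ⊑-refl 0≼μ = dominated λ f g f≼g → expectation-mono (λ s → f≼g ≡.refl) 0≼μ

  -- Couple the coordinates independently. In dual form, domination in the second coordinate
  -- provides the pointwise comparison that domination in the first one asks for.
  ⊑-independent : ∀ {S′ T′ : Set} {P : S → S′ → Set} {Q : T → T′ → Set}
    (K : Kernel S) (M : Kernel T) (K′ : Kernel S′) (M′ : Kernel T′) {s t s′ t′} →
    K s ⊑[ P ] K′ s′ → M t ⊑[ Q ] M′ t′ →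
    independent K M (s , t) ⊑[ (λ (u , v) (u′ , v′) → P u u′ × Q v v′) ]
    independent K′ M′ (s′ , t′)
  ⊑-independent K M K′ M′ {s} {t} {s′} {t′} K⊑ M⊑ = dominated λ f g f≼g → begin
    expectation f (independent K M (s , t))
      ≈⟨ expectation-product f K M s t ⟩
    expectation (λ u → expectation (λ v → f (u , v)) (M t)) (K s)
      ≤⟨ expectation-≼ K⊑ _ _ (λ Puu′ → expectation-≼ M⊑ _ _ (λ Qvv′ → f≼g (Puu′ , Qvv′))) ⟩
    expectation (λ u → expectation (λ v → g (u , v)) (M′ t′)) (K′ s′)
      ≈⟨ expectation-product g K′ M′ s′ t′ ⟨
    expectation g (independent K′ M′ (s′ , t′)) ∎

  absorbing-outside : ∀ {A : Pred S 0ℓ} (A? : Decidable A) (K : Kernel S) {s} →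
    ¬ A s → absorbing A? K s ≡ K s
  absorbing-outside A? K {s} ¬As rewrite dec-false (A? s) ¬As = ≡.refl

  ⊑-absorbing : ∀ {A : Pred S 0ℓ} {B : Pred T 0ℓ} (A? : Decidable A) (B? : Decidable B)
    (K : Kernel S) (M : Kernel T) (_∼_ : S → T → Set) s t → ¬ A s → ¬ B t →
    K s ⊑[ _∼_ ] M t → absorbing A? K s ⊑[ _∼_ ] absorbing B? M t
  ⊑-absorbing A? B? K M _∼_ s t ¬As ¬Bt = ≡.subst₂ (_⊑[ _∼_ ]_)
    (≡.sym (absorbing-outside A? K ¬As)) (≡.sym (absorbing-outside B? M ¬Bt))

  -- The coupling argument behind all three comparisons, by induction on the cap N. Once `s` has
  -- hit, the left side is 0. Otherwise `t` has not hit either, both sides unfold by one step, and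
  -- the domination in `step` is applied to the capped expectations themselves as test functions.
  expectedHit-mono : ∀ {A : Pred S 0ℓ} {B : Pred T 0ℓ} (A? : Decidable A) (B? : Decidable B)
    {K : Kernel S} {M : Kernel T} → Stochastic K → Stochastic M → (_∼_ : S → T → Set) →
    (∀ {s t} → s ∼ t → B t → A s) →
    (∀ {s t} → s ∼ t → ¬ A s → ¬ B t → K s ⊑[ _∼_ ] M t) →
    ∀ {s t} → s ∼ t → expectedHit A? K s ≤± expectedHit B? M t
  expectedHit-mono A? B? {K} {M} stK stM _∼_ B⇒A step s∼t = ⨆-mono (λ N → [ go N s∼t ])
    where
    go : ∀ N {s t} → s ∼ t → E[T∧_] A? stK N s ≼ E[T∧_] B? stM N t
    go zero    {s} {t} s∼t = ≼-refl
    go (suc N) {s} {t} s∼t with A? s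
    ... | yes As = begin
      E[T∧_] A? stK (suc N) s ≈⟨ E[T∧N]-hit A? stK (suc N) As ⟩
      0#                      ≤⟨ E[T∧N]-nonNegative B? stM (suc N) t ⟩
      E[T∧_] B? stM (suc N) t ∎
    ... | no ¬As = begin
      E[T∧_] A? stK (suc N) s                  ≈⟨ E[T∧N]-step A? stK N ¬As ⟩
      1# + expectation (E[T∧_] A? stK N) (K s) ≤⟨ +-mono ≼-refl (expectation-≼ (step s∼t ¬As ¬Bt) _ _ (go N)) ⟩
      1# + expectation (E[T∧_] B? stM N) (M t) ≈⟨ E[T∧N]-step B? stM N ¬Bt ⟨
      E[T∧_] B? stM (suc N) t                  ∎
      where
      ¬Bt : ¬ _
      ¬Bt = ¬As ∘ B⇒A s∼t

  -- Walks

  expectation-walk : ∀ b i (f : ℤ → Carrier) → expectation f (walk b i) ≈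
    b i * f (i ℤ.+ 1ℤ) + (1# - b i) * f (i ℤ.- 1ℤ)
  expectation-walk b i f = +-congˡ (+-identityʳ _)

  -- The probabilities matter only when the two walks share a site; from distance at least 2 every
  -- pair of steps preserves the order. The `Neighbour` component remembers that `u′` is one step
  -- from `x′`, which `⊒-neighbours` will require.
  walk-⊒ : ∀ {b b′} → (∀ i → InUnit (b i)) → (∀ i → InUnit (b′ i)) → (∀ i → b i ≼ b′ i) →
    ∀ {x′ x} → x′ ⊒ x → walk b′ x′ ⊑[ (λ u′ u → Neighbour x′ u′ × u′ ⊒ u) ] walk b x
  walk-⊒ {b} {b′} b∈ b′∈ b≼b′ {x′} {x} x′⊒x = dominated λ f g f≼g → begin
    expectation f (walk b′ x′) ≈⟨ expectation-walk b′ x′ f ⟩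
    b′ x′ * f (x′ ℤ.+ 1ℤ) + (1# - b′ x′) * f (x′ ℤ.- 1ℤ)
      ≤⟨ convex-mono (proj₁ (b∈ x)) (proj₁ (1-x∈[0,1] (b∈ x)))
           (proj₁ (b′∈ x′)) (proj₁ (1-x∈[0,1] (b′∈ x′)))
           (x+[y-x]≈y (b x) 1#) (x+[y-x]≈y (b′ x′) 1#)
           (f≼g (inj₁ ≡.refl , ⊒-shift 1ℤ x′⊒x))
           (f≼g (inj₂ ≡.refl , ⊒-shift ℤ.-1ℤ x′⊒x))
           (f≼g (inj₁ ≡.refl , ⊒-apart x′⊒x))
           (crossed f g f≼g) ⟩
    b x * g (x ℤ.+ 1ℤ) + (1# - b x) * g (x ℤ.- 1ℤ) ≈⟨ expectation-walk b x g ⟨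
    expectation g (walk b x) ∎
    where
    -- The dangerous pair, upper walk down and lower walk up: harmless at positive distance, and at
    -- distance 0 replaced by the comparison of `b` with `b′`.
    crossed : ∀ f g → (∀ {u′ u} → Neighbour x′ u′ × u′ ⊒ u → f u′ ≼ g u) →
      f (x′ ℤ.- 1ℤ) ≼ g (x ℤ.+ 1ℤ) ⊎ b x ≼ b′ x′
    crossed f g f≼g with ⊒-approach x′⊒x
    ... | inj₁ ≡.refl = inj₂ (b≼b′ x)
    ... | inj₂ closer = inj₁ (f≼g (inj₂ ≡.refl , closer))

  -- The mirror image of `walk-⊒`: the sums are commuted so that the down-probabilities `1# - b`
  -- take the leading place in `convex-mono`.
  walk-⊑ : ∀ {b b′} → (∀ i → InUnit (b i)) → (∀ i → InUnit (b′ i)) → (∀ i → b′ i ≼ b i) →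
    ∀ {y′ y} → y ⊒ y′ → walk b′ y′ ⊑[ (λ v′ v → Neighbour y′ v′ × v ⊒ v′) ] walk b y
  walk-⊑ {b} {b′} b∈ b′∈ b′≼b {y′} {y} y⊒y′ = dominated λ f g f≼g → begin
    expectation f (walk b′ y′) ≈⟨ trans (expectation-walk b′ y′ f) (+-comm _ _) ⟩
    (1# - b′ y′) * f (y′ ℤ.- 1ℤ) + b′ y′ * f (y′ ℤ.+ 1ℤ)
      ≤⟨ convex-mono (proj₁ (1-x∈[0,1] (b∈ y))) (proj₁ (b∈ y))
           (proj₁ (1-x∈[0,1] (b′∈ y′))) (proj₁ (b′∈ y′))
           (trans (+-comm _ _) (x+[y-x]≈y (b y) 1#))
           (trans (+-comm _ _) (x+[y-x]≈y (b′ y′) 1#))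
           (f≼g (inj₂ ≡.refl , ⊒-shift ℤ.-1ℤ y⊒y′))
           (f≼g (inj₁ ≡.refl , ⊒-shift 1ℤ y⊒y′))
           (f≼g (inj₂ ≡.refl , ⊒-apart y⊒y′))
           (crossed f g f≼g) ⟩
    (1# - b y) * g (y ℤ.- 1ℤ) + b y * g (y ℤ.+ 1ℤ)
      ≈⟨ trans (expectation-walk b y g) (+-comm _ _) ⟨
    expectation g (walk b y) ∎
    where
    crossed : ∀ f g → (∀ {v′ v} → Neighbour y′ v′ × v ⊒ v′ → f v′ ≼ g v) →
      f (y′ ℤ.+ 1ℤ) ≼ g (y ℤ.- 1ℤ) ⊎ 1# - b y ≼ 1# - b′ y′
    crossed f g f≼g with ⊒-approach y⊒y′
    ... | inj₂ closer = inj₁ (f≼g (inj₁ ≡.refl , closer))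
    ... | inj₁ ≡.refl = inj₂ (+-mono ≼-refl (neg-antitone (b′≼b y)))

  -- The only exits from the interval are up from k and down from -k, and both have weight 0; inside
  -- it the two walks have the same probabilities.
  walk-confined : ∀ {b b′ k} → 1 ≤ k → b (+ k) ≈ 0# → b (ℤ.- + k) ≈ 1# →
    (∀ i → InUnit (b i)) → (∀ i → ∣ i ∣ ≤ k → b i ≈ b′ i) →
    ∀ {i} → ∣ i ∣ ≤ k → walk b i ⊑[ (λ u v → u ≡ v × ∣ u ∣ ≤ k) ] walk b′ i
  walk-confined {b} {b′} {k} 1≤k bk≈0 b-k≈1 b∈ b≈b′ {i} ∣i∣≤k =
    dominated λ f g f≼g → +-mono (up f g f≼g) (+-mono (down f g f≼g) ≼-refl)
    where
    AtMost : (f g : ℤ → Carrier) → Set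
    AtMost f g = ∀ {u v} → u ≡ v × ∣ u ∣ ≤ k → f u ≼ g v

    up : ∀ f g → AtMost f g → b i * f (i ℤ.+ 1ℤ) ≼ b′ i * g (i ℤ.+ 1ℤ)
    up f g f≼g = begin
      b i * f (i ℤ.+ 1ℤ)  ≤⟨ *-monoˡ-support (proj₁ (b∈ i))
        (Sum.map (λ inside → f≼g (≡.refl , inside)) (λ { ≡.refl → bk≈0 })
          (∣i+1∣≤k i ∣i∣≤k)) ⟩
      b i * g (i ℤ.+ 1ℤ)  ≈⟨ *-congʳ (b≈b′ i ∣i∣≤k) ⟩
      b′ i * g (i ℤ.+ 1ℤ) ∎

    down : ∀ f g → AtMost f g → (1# - b i) * f (i ℤ.- 1ℤ) ≼ (1# - b′ i) * g (i ℤ.- 1ℤ)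
    down f g f≼g = begin
      (1# - b i) * f (i ℤ.- 1ℤ)  ≤⟨ *-monoˡ-support (proj₁ (1-x∈[0,1] (b∈ i)))
        (Sum.map (λ inside → f≼g (≡.refl , inside))
          (λ { ≡.refl → trans (+-congˡ (-‿cong b-k≈1)) (-‿inverseʳ 1#) })
          (∣i-1∣≤k i 1≤k ∣i∣≤k)) ⟩
      (1# - b i) * g (i ℤ.- 1ℤ)  ≈⟨ *-congʳ (+-congˡ (-‿cong (b≈b′ i ∣i∣≤k))) ⟩
      (1# - b′ i) * g (i ℤ.- 1ℤ) ∎

  -- Signed sequences and parameter vectors

  signed-cong : ∀ {a a′} k → (∀ i → i ≤ k → a i ≈ a′ i) →
    ∀ i → ∣ i ∣ ≤ k → signed a i ≈ signed a′ i
  signed-cong k a≈a′ (+ i)    i≤k = a≈a′ i i≤k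
  signed-cong k a≈a′ -[1+ i ] i<k = +-congˡ (-‿cong (a≈a′ (suc i) i<k))

  signed∈[0,1] : ∀ {a} → (∀ i → InUnit (a i)) → ∀ i → InUnit (signed a i)
  signed∈[0,1] a∈ (+ i)    = a∈ i
  signed∈[0,1] a∈ -[1+ i ] = 1-x∈[0,1] (a∈ (suc i))

  stochastic-walks : ∀ {b b′} → (∀ i → InUnit (b i)) → (∀ i → InUnit (b′ i)) →
    Stochastic (independent (walk b) (walk b′))
  stochastic-walks b∈ b′∈ = stochastic-independent (stochastic-walk b∈) (stochastic-walk b′∈)

  extend-∈[0,1] : ∀ n {a} → InCube n a → ∀ i → InUnit (extend n a i)
  extend-∈[0,1] n a∈ zero = ½∈[0,1]
  extend-∈[0,1] n a∈ (suc i) with i ℕ.<? (n ℕ.∸ 1)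
  ... | yes i<n-1 = a∈ (fromℕ< i<n-1)
  ... | no  _     = 0∈[0,1]

  extend-admissible : ∀ n {a} → InCube n a → Admissible (extend n a)
  extend-admissible n a∈ = record { start = refl ; inUnit = extend-∈[0,1] n a∈ }

  -- Entry k would be stored at index k - 1, which is the length of the vector, so `extend` falls
  -- through to its default 0. This default is the reflection of the truncated walk at k.
  extend-end : ∀ k a → 1 ≤ k → extend k a k ≡ 0#
  extend-end (suc k) a _ with k ℕ.<? k
  ... | yes k<k = ⊥-elim (ℕ.<-irrefl ≡.refl k<k)
  ... | no  _   = ≡.refl

  extend-prefix : ∀ {k n} (k≤n : k ≤ n) a → ∀ i → i < k →
    extend k (prefix k≤n a) i ≡ extend n a i
  extend-prefix k≤n a zero _ = ≡.refl
  extend-prefix {suc k} {n} k≤n a (suc i) (s≤s i<k) with i ℕ.<? k | i ℕ.<? (n ℕ.∸ 1)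
  ... | no i≮k    | _         = ⊥-elim (i≮k i<k)
  ... | yes _     | no i≮n-1  = ⊥-elim (i≮n-1 (ℕ.<-≤-trans i<k (ℕ.∸-monoˡ-≤ 1 k≤n)))
  ... | yes i<k   | yes i<n-1 = ≡.cong a (toℕ-injective
    (≡.trans (toℕ-inject≤ _ _) (≡.trans (toℕ-fromℕ< i<k) (≡.sym (toℕ-fromℕ< i<n-1)))))

  restrict : ∀ n → (ℕ → Carrier) → Parameters n
  restrict n a i = a (suc (toℕ i))

  extend-restrict : ∀ n {a : ℕ → Carrier} → a 0 ≈ ½ → ∀ i → i < n → extend n (restrict n a) i ≈ a i
  extend-restrict n a₀≈½ zero _ = sym a₀≈½
  extend-restrict (suc n) {a} a₀≈½ (suc i) (s≤s i<n) with i ℕ.<? n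
  ... | yes i<n = reflexive (≡.cong (a ∘ suc) (toℕ-fromℕ< i<n))
  ... | no  i≮n = ⊥-elim (i≮n i<n)

  -- Transition probabilities of the weak-peek chain

  module _ (n : ℕ) (a : Parameters n) (a∈ : InCube n a) where

    private
      b : ℤ → Carrier
      b = signed (extend n a)

    -- Copies of the local functions of `weakPeek`, restated so that they can be named; they unfold
    -- to the same terms.
    up₁ up₂ : ℤ → Carrier
    up₁ i = if does (n ℕ.≤? ∣ i ∣) then 1# else b i
    up₂ i = if does (n ℕ.≤? ∣ i ∣) then 0# else b i

    up₁∈[0,1] : ∀ i → InUnit (up₁ i)
    up₁∈[0,1] i = if-dec-elim InUnit (n ℕ.≤? ∣ i ∣)
      (λ _ → 1∈[0,1]) (λ _ → signed∈[0,1] (extend-∈[0,1] n a∈) i)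

    up₂∈[0,1] : ∀ i → InUnit (up₂ i)
    up₂∈[0,1] i = if-dec-elim InUnit (n ℕ.≤? ∣ i ∣)
      (λ _ → 0∈[0,1]) (λ _ → signed∈[0,1] (extend-∈[0,1] n a∈) i)

    up₁-inside : ∀ i → ∣ i ∣ < n → up₁ i ≡ b i
    up₁-inside i ∣i∣<n = if-dec-elim (_≡ b i) (n ℕ.≤? ∣ i ∣)
      (λ n≤∣i∣ → ⊥-elim (ℕ.<⇒≱ ∣i∣<n n≤∣i∣)) (λ _ → ≡.refl)

    up₂-inside : ∀ i → ∣ i ∣ < n → up₂ i ≡ b i
    up₂-inside i ∣i∣<n = if-dec-elim (_≡ b i) (n ℕ.≤? ∣ i ∣)
      (λ n≤∣i∣ → ⊥-elim (ℕ.<⇒≱ ∣i∣<n n≤∣i∣)) (λ _ → ≡.refl)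

    -- Outside the window the weak-peek chain uses the extreme value 1 here, and 0 in `up₂-lower`,
    -- so it dominates any strategy that agrees with it inside.
    up₁-upper : ∀ {c : ℤ → Carrier} → (∀ i → InUnit (c i)) → (∀ i → ∣ i ∣ < n → c i ≈ b i) →
      ∀ i → c i ≼ up₁ i
    up₁-upper {c} c∈ c≈b i = if-dec-elim (c i ≼_) (n ℕ.≤? ∣ i ∣)
      (λ _ → proj₂ (c∈ i)) (λ n≰∣i∣ → ≼-reflexive (c≈b i (ℕ.≰⇒> n≰∣i∣)))

    up₂-lower : ∀ {c : ℤ → Carrier} → (∀ i → InUnit (c i)) → (∀ i → ∣ i ∣ < n → c i ≈ b i) →
      ∀ i → up₂ i ≼ c i
    up₂-lower {c} c∈ c≈b i = if-dec-elim (_≼ c i) (n ℕ.≤? ∣ i ∣)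
      (λ _ → proj₁ (c∈ i)) (λ n≰∣i∣ → ≼-reflexive (sym (c≈b i (ℕ.≰⇒> n≰∣i∣))))

    stochastic-weakPeek : ∀ d → Stochastic (weakPeek d n a)
    stochastic-weakPeek d = stochastic-absorbing (absorbed? d)
      (stochastic-walks up₁∈[0,1] up₂∈[0,1])

    stochastic-truncated : ∀ d → Stochastic (truncated d n a)
    stochastic-truncated d = stochastic-absorbing (absorbed? d) (stochastic-walks b∈ b∈)
      where
      b∈ : ∀ i → InUnit (b i)
      b∈ = signed∈[0,1] (extend-∈[0,1] n a∈)

  -- The three comparisons of expected hitting times

  E𝒯≤U : ∀ d n {a} → InCube n a → E𝒯 d (extend n a) ≤± U d n a
  E𝒯≤U d n {a} a∈ = expectedHit-mono (meet? d) (absorbed? d) stochastic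
    -- The identity coupling suffices: the two chains have equal kernels until they meet, and only
    -- the truncated one is frozen from then on.
    (stochastic-truncated n a a∈ d) _≡_ (λ { ≡.refl → absorbed⇒meet _ }) step ≡.refl
    where
    b : ℤ → Carrier
    b = signed (extend n a)

    stochastic : Stochastic (independent (walk b) (walk b))
    stochastic = stochastic-walks b∈ b∈
      where
      b∈ : ∀ i → InUnit (b i)
      b∈ = signed∈[0,1] (extend-∈[0,1] n a∈)

    step : ∀ {s t} → s ≡ t → ¬ Meet d s → ¬ Absorbed d t →
      independent (walk b) (walk b) s ⊑[ _≡_ ] truncated d n a t
    step {s} ≡.refl _ ¬absorbed = ≡.subst (independent (walk b) (walk b) s ⊑[ _≡_ ]_)
      (≡.sym (absorbing-outside (absorbed? d) (independent (walk b) (walk b)) {s} ¬absorbed))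
      (⊑-refl (proj₁ (stochastic s)))

  U≤Lʷᵖ : ∀ d {k n} (k<n : k < n) {a} → InCube n a → 1 ≤ k → extend n a k ≈ 0# →
    U d k (prefix (<⇒≤ k<n) a) ≤± Lʷᵖ d n a
  U≤Lʷᵖ d {k} {n} k<n {a} a∈ 1≤k aₖ≈0 = expectedHit-mono (absorbed? d) (absorbed? d)
    (stochastic-truncated k a′ a′∈ d) (stochastic-weakPeek n a a∈ d)
    _∼_ (λ { (≡.refl , _) At → At }) step (≡.refl , z≤n , z≤n)
    where
    Inside : ℤ × ℤ → Set
    Inside (x , y) = ∣ x ∣ ≤ k × ∣ y ∣ ≤ k

    a′ : Parameters k
    a′ = prefix (<⇒≤ k<n) a

    a′∈ : InCube k a′
    a′∈ i = a∈ _

    b′ : ℤ → Carrier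
    b′ = signed (extend k a′)

    b′≈b : ∀ i → ∣ i ∣ ≤ k → b′ i ≈ signed (extend n a) i
    b′≈b = signed-cong k agree
      where
      agree : ∀ i → i ≤ k → extend k a′ i ≈ extend n a i
      agree i i≤k with ℕ.m≤n⇒m<n∨m≡n i≤k
      ... | inj₁ i<k    = reflexive (extend-prefix (<⇒≤ k<n) a i i<k)
      -- The hypothesis aₖ = 0 enters here: it matches the default value at the end of the truncated
      -- sequence.
      ... | inj₂ ≡.refl = trans (reflexive (extend-end k a′ 1≤k)) (sym aₖ≈0)

    confined : ∀ {up} → (∀ i → ∣ i ∣ ≤ k → signed (extend n a) i ≈ up i) →
      ∀ {i} → ∣ i ∣ ≤ k → walk b′ i ⊑[ (λ u v → u ≡ v × ∣ u ∣ ≤ k) ] walk up i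
    confined b≈up = walk-confined 1≤k (reflexive (extend-end k a′ 1≤k)) (b′-k≈1 1≤k)
      (signed∈[0,1] (extend-∈[0,1] k a′∈)) (λ i i≤k → trans (b′≈b i i≤k) (b≈up i i≤k))
      where
      b′-k≈1 : 1 ≤ k → b′ (ℤ.- + k) ≈ 1#
      -- Matching on `s≤s` exposes k as a successor, so that `signed` computes at -k to `1#` minus
      -- entry k.
      b′-k≈1 (s≤s _) = trans (+-congˡ (-‿cong (reflexive (extend-end k a′ 1≤k)))) 1-0≈1

    _∼_ : ℤ × ℤ → ℤ × ℤ → Set
    s ∼ t = s ≡ t × Inside s

    up₁′ up₂′ : ℤ → Carrier
    up₁′ = up₁ n a a∈
    up₂′ = up₂ n a a∈

    step : ∀ {s t} → s ∼ t → ¬ Absorbed d s → ¬ Absorbed d t →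
      truncated d k a′ s ⊑[ _∼_ ] weakPeek d n a t
    step {x , y} (≡.refl , ∣x∣≤k , ∣y∣≤k) ¬As ¬Bt =
      ⊑-absorbing (absorbed? d) (absorbed? d)
        (independent (walk b′) (walk b′)) (independent (walk up₁′) (walk up₂′))
        _∼_ (x , y) (x , y) ¬As ¬Bt
        (⊑-weaken (λ { ((≡.refl , ∣u∣≤k) , (≡.refl , ∣v∣≤k)) → ≡.refl , ∣u∣≤k , ∣v∣≤k })
          (⊑-independent (walk b′) (walk b′) (walk up₁′) (walk up₂′) {x} {y} {x} {y}
            (confined {up₁′} (λ i i≤k →
              reflexive (≡.sym (up₁-inside n a a∈ i (ℕ.≤-<-trans i≤k k<n)))) {x} ∣x∣≤k)
            (confined {up₂′} (λ i i≤k →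
              reflexive (≡.sym (up₂-inside n a a∈ i (ℕ.≤-<-trans i≤k k<n)))) {y} ∣y∣≤k)))

  Lʷᵖ≤E𝒯 : ∀ d n {a} → Admissible a → Lʷᵖ d n (restrict n a) ≤± E𝒯 d a
  Lʷᵖ≤E𝒯 d n {a} adm = expectedHit-mono (absorbed? d) (meet? d)
    (stochastic-weakPeek n a′ a′∈ d) (stochastic-walks b∈ b∈)
    _∼_ (λ {s} {t} → meet {s} {t}) step
    -- The initial gap 2d has half `d`; the equation removes the trailing 0 in `2 * d`, which
    -- computes to `d + (d + 0)`.
    (⊒-refl 0ℤ , ⊒-refl 0ℤ , gap d (≡.cong (λ j → + (d ℕ.+ j)) (ℕ.+-identityʳ d)))
    where
    open Admissible adm using (inUnit) renaming (start to a₀≈½)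

    c : ℤ
    c = + (2 ℕ.* d)

    a′ : Parameters n
    a′ = restrict n a

    a′∈ : InCube n a′
    a′∈ i = inUnit _

    b : ℤ → Carrier
    b = signed a

    b∈ : ∀ i → InUnit (b i)
    b∈ = signed∈[0,1] inUnit

    b≈b′ : ∀ i → ∣ i ∣ < n → b i ≈ signed (extend n a′) i
    b≈b′ i i<n = signed-cong ∣ i ∣
      (λ j j≤i → sym (extend-restrict n {a} a₀≈½ j (ℕ.≤-<-trans j≤i i<n))) i ℕ.≤-refl

    -- The first two clauses are the ordering of the coupled walks; the third says that the
    -- weak-peek pair has not jumped past the absorbing distance.
    _∼_ : ℤ × ℤ → ℤ × ℤ → Set
    (x′ , y′) ∼ (x , y) = x′ ⊒ x × y ⊒ y′ × y′ ℤ.+ c ⊒ x′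

    meet : ∀ {s t} → s ∼ t → Meet d t → Absorbed d s
    meet {x′ , y′} {x , y} (x′⊒x , y⊒y′ , y′+c⊒x′) ≡.refl = meet⇒absorbed c
      -- A squeeze: x′ ≤ y′ + c ≤ y + c = x ≤ x′.
      (ℤ.≤-antisym (⊒⇒≥ y′+c⊒x′) (ℤ.≤-trans (ℤ.+-monoˡ-≤ c (⊒⇒≥ y⊒y′)) (⊒⇒≥ x′⊒x)))

    up₁′ up₂′ : ℤ → Carrier
    up₁′ = up₁ n a′ a′∈
    up₂′ = up₂ n a′ a′∈

    step : ∀ {s t} → s ∼ t → ¬ Absorbed d s → ¬ Meet d t →
      weakPeek d n a′ s ⊑[ _∼_ ] independent (walk b) (walk b) t
    step {x′ , y′} {x , y} (x′⊒x , y⊒y′ , y′+c⊒x′) ¬As _ =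
      ≡.subst (_⊑[ _∼_ ] independent (walk b) (walk b) (x , y))
        (≡.sym (absorbing-outside (absorbed? d) (independent (walk up₁′) (walk up₂′)) {x′ , y′} ¬As))
        (⊑-weaken
          (λ ((near₁ , u′⊒u) , (near₂ , v⊒v′)) → u′⊒u , v⊒v′ ,
            ⊒-neighbours {y = y′} c (¬As ∘ meet⇒absorbed c) y′+c⊒x′ near₁ near₂)
          (⊑-independent (walk up₁′) (walk up₂′) (walk b) (walk b) {x′} {y′} {x} {y}
            (walk-⊒ b∈ (up₁∈[0,1] n a′ a′∈) (up₁-upper n a′ a′∈ b∈ b≈b′) x′⊒x)
            (walk-⊑ b∈ (up₂∈[0,1] n a′ a′∈) (up₂-lower n a′ a′∈ b∈ b≈b′) y⊒y′)))

lemma6 : (em : ExcludedMiddle 0ℓ) (ℝ : CompleteOrderedField) →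
    let open Rendezvous em ℝ in
    (d n : ℕ) → 1 ≤ d → d < n →
    (a : Parameters n) → IsGlobalMinimizer n (Lʷᵖ d n) a →
    (k : ℕ) → d ≤ k → (k<n : k < n) → extend n a k ≈ 0# →
    R d ≈± U d k (prefix (<⇒≤ k<n) a) ×
    Optimal d (extend k (prefix (<⇒≤ k<n) a))
lemma6 em ℝ d n 1≤d d<n a (a∈ , minimal) k d≤k k<n aₖ≈0 =
  ≤±-antisym antisym (≤±-trans ≼-trans R≤E𝒯 E𝒯≤U′) (≤±-trans ≼-trans U≤L L≤R) ,
  admissible ,
  ≤±-antisym antisym (≤±-trans ≼-trans E𝒯≤U′ (≤±-trans ≼-trans U≤L L≤R)) R≤E𝒯
  where
  open Rendezvous em ℝ
  open OrderedField ℝ using (antisym; ≼-trans)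

  a′ : Parameters k
  a′ = prefix (<⇒≤ k<n) a

  admissible : Admissible (extend k a′)
  admissible = extend-admissible em ℝ k (λ i → a∈ _)

  R≤E𝒯 : R d ≤± E𝒯 d (extend k a′)
  R≤E𝒯 = proj₁ (proj₂ (infimum {∃ Admissible} (λ (a , _) → E𝒯 d a))) (extend k a′ , admissible)

  E𝒯≤U′ : E𝒯 d (extend k a′) ≤± U d k a′
  E𝒯≤U′ = E𝒯≤U em ℝ d k (λ i → a∈ _)

  U≤L : U d k a′ ≤± Lʷᵖ d n a
  U≤L = U≤Lʷᵖ em ℝ d k<n a∈ (ℕ.≤-trans 1≤d d≤k) aₖ≈0

  L≤R : Lʷᵖ d n a ≤± R d
  -- `Lʷᵖ d n a` is a lower bound for the family defining `R d`: minimality of `a` is used against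
  -- the restriction of each admissible sequence.
  L≤R = proj₂ (proj₂ (infimum {∃ Admissible} (λ (a , _) → E𝒯 d a))) (Lʷᵖ d n a)
    λ (a″ , adm) → ≤±-trans ≼-trans
      (minimal (restrict em ℝ n a″) (λ i → Rendezvous.Admissible.inUnit adm _))
      (Lʷᵖ≤E𝒯 em ℝ d n adm)
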